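{- Let $M$ be a Kripke model with yesterday and $U$ an action model over $L_{\mathsf{DETL}}$, and suppose $M,w^*\models\mathrm{pre}^U(s^*)$ for some $w^*\in W^M$ and $s^*\in W^U$ (so $M[U]$ is a Kripke model). Then: (a) If $M$ satisfies persistence of facts, then so does $M[U]$. (b) If $M$ and $U$ are depth-defined, then so is $M[U]$. (c) If $M$ and $U$ satisfy knowledge of the past and $U$ is history preserving, then $M[U]$ satisfies knowledge of the past. (d) If $M$ satisfies knowledge of the initial time and $U$ is history preserving, then $M[U]$ satisfies knowledge of the initial time. (e) If $M$ and $U$ satisfy uniqueness of the past, then so does $M[U]$. (f) If $M$ and $U$ satisfy perfect recall and $U$ is history preserving, then $M[U]$ satisfies perfect recall. (g) If $M$ and $U$ are synchronous and $U$ is history preserving, then $M[U]$ is synchronous.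
   Context: Fix a nonempty finite set $\mathsf{Agt}$ of agents and a nonempty set $\mathsf{Prop}$ of letters. A Kripke model (with yesterday) is $M=(W^M,(\to^M_a)_{a\in\mathsf{Agt}},\leadsto^M,V^M)$ with $W^M$ a nonempty set, binary relations $\to^M_a,\leadsto^M$ on $W^M$ ($w'\leadsto w$: $w'$ is a yesterday of $w$), $V^M:\mathsf{Prop}\to\mathcal P(W^M)$. An action model over a set $F$ of formulas is $U=(W^U,(\to^U_a)_a,\leadsto^U,\mathrm{pre}^U)$ with $W^U$ nonempty finite, binary relations $\to^U_a,\leadsto^U$, and $\mathrm{pre}^U:W^U\to F$. An event $s$ is a past state if there is no $s'\leadsto^Us$. $L_{\mathsf{DETL}}$ (with action models over it) is given by $\varphi::=p\mid\neg\varphi\mid\varphi\wedge\varphi\mid\Box_a\varphi\mid[Y]\varphi\mid[U,s]\varphi$. Semantics: Boolean standard; $M,w\models\Box_a\varphi$ iff $\varphi$ holds at all $v$ with $w\to^M_av$; $M,w\models[Y]\varphi$ iff $\varphi$ holds at all $v\leadsto^Mw$; $M,w\models[U,s]\varphi$ iff $M,w\models\mathrm{pre}^U(s)$ implies $M[U],(w,s)\models\varphi$. The product $M[U]$ has worlds $\{(v,t)\in W^M\times W^U:M,v\models\mathrm{pre}^U(t)\}$, $(v,t)\to_a(v',t')$ iff $v\to^M_av'$ and $t\to^U_at'$, $(v',t')\leadsto(v,t)$ iff ($v'\leadsto^Mv$, $t'=t$, $t$ a past state) or ($v'=v$, $t'\leadsto^Ut$), and $(v,t)\in V(p)$ iff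 $v\in V^M(p)$. $\models\varphi$ means truth at all pointed Kripke models. A progression is a finite nonempty sequence $x_0,\dots,x_n$ with $x_i\leadsto x_{i+1}$, of length $n$; a history is a progression that cannot be extended by adding elements at the beginning. $\mathrm{depth}(x)$ is the maximum length of a history ending at $x$ if the maximum exists, else $\infty$. The following apply to Kripke models or action models (with worlds/events $w,v,\dots$), except where noted: Persistence of facts (Kripke models only): $w\leadsto w'$ implies ($w\in V(p)\iff w'\in V(p)$) for all $p$. Depth-definedness: $\mathrm{depth}(w)\ne\infty$ for all $w$. Knowledge of the past: $w'\leadsto w\to_a v$ implies there is $v'$ with $v'\leadsto v$. Knowledge of the initial time: if $w\to_av$ and there is no $w'\leadsto w$ then there is no $v'\leadsto v$. Uniqueness of the past: $w'\leadsto w$ and $w''\leadsto w$ imply $w'=w''$. Perfect recall: $w\leadsto v\to_a v'$ implies there is $w'$ with $w\to_aw'\leadsto v'$. Synchronicity: the structure is depth-defined and $w\to_aw'$ implies $\mathrm{depth}(w)=\mathrm{depth}(w')$. An epistemic past state of $U$ is a past state $s$ with $\models\mathrm{pre}^U(s)$ whose only outgoing epistemic arrows are the reflexive arrows $s\to^U_as$ for each $a\in\mathsf{Agt}$. History preservation (action models only): $s'\leadsto^Us$ implies $\models\mathrm{pre}^U(s)\to\mathrm{pre}^U(s')$, and every past state of $U$ is an epistemic past state. -}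

module Defs where

open import Data.Fin.Base using (Fin)
open import Data.Nat.Base using (ℕ; zero; suc; _≤_)
open import Data.Product.Base using (∃-syntax; _×_)
open import Data.Sum.Base using (_⊎_)
open import Function.Bundles using (_↔_; _⇔_)
open import Relation.Binary.PropositionalEquality using (_≡_)
open import Relation.Nullary.Construct.Add.Supremum using (_⁺) renaming ([_] to fin; ⊤⁺ to ∞)
open import Relation.Nullary.Negation using (¬_)

NonemptyFinite : Set → Set
NonemptyFinite A = ∃[ n ] (A ↔ Fin (suc n))

record Signature : Set₁ where
  field
    Agent        : Set
    agent-finite : NonemptyFinite Agent
    Letter       : Set
    letter       : Letter

open Signature public

-- The relational part shared by Kripke models and action models.
-- x' ⇝ x : x' is a yesterday of x.

record Frame (S : Signature) : Set₁ where
  infix 4 _⟶⟨_⟩_ _⇝_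
  field
    Point   : Set
    _⟶⟨_⟩_ : Point → Agent S → Point → Set
    _⇝_     : Point → Point → Set

module _ {S : Signature} (F : Frame S) where
  open Frame F

  PastState : Point → Set
  PastState x = ¬ (∃[ x' ] x' ⇝ x)

  -- Progression x₀ x n : a progression of length n from x₀ to x.
  data Progression : Point → Point → ℕ → Set where
    single : ∀ {x} → Progression x x zero
    _∷_    : ∀ {x y z n} → x ⇝ y → Progression y z n → Progression x z (suc n)

  HistoryEndingAt : Point → ℕ → Set
  HistoryEndingAt x n = ∃[ x₀ ] (Progression x₀ x n × PastState x₀)

  MaxHistoryLength : Point → ℕ → Set
  MaxHistoryLength x n = HistoryEndingAt x n × (∀ m → HistoryEndingAt x m → m ≤ n)

  -- The graph of depth : Point → ℕ ∪ {∞}; a relation, since the maximum cannot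
  -- in general be computed.
  HasDepth : Point → ℕ ⁺ → Set
  HasDepth x (fin n) = MaxHistoryLength x n
  HasDepth x ∞          = ¬ (∃[ n ] MaxHistoryLength x n)

  SameDepth : Point → Point → Set
  SameDepth x y = ∀ d → HasDepth x d ⇔ HasDepth y d

  DepthDefined : Set
  DepthDefined = ∀ w → ¬ HasDepth w ∞

  KnowledgeOfThePast : Set
  KnowledgeOfThePast = ∀ {w' w v a} → w' ⇝ w → w ⟶⟨ a ⟩ v → ∃[ v' ] v' ⇝ v

  KnowledgeOfTheInitialTime : Set
  KnowledgeOfTheInitialTime =
    ∀ {w v a} → w ⟶⟨ a ⟩ v → ¬ (∃[ w' ] w' ⇝ w) → ¬ (∃[ v' ] v' ⇝ v)

  UniquenessOfThePast : Set
  UniquenessOfThePast = ∀ {w' w'' w} → w' ⇝ w → w'' ⇝ w → w' ≡ w''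

  PerfectRecall : Set
  PerfectRecall =
    ∀ {w v v' a} → w ⇝ v → v ⟶⟨ a ⟩ v' → ∃[ w' ] (w ⟶⟨ a ⟩ w' × w' ⇝ v')

  Synchronous : Set
  Synchronous = DepthDefined × (∀ {w w' a} → w ⟶⟨ a ⟩ w' → SameDepth w w')

-- Nonemptiness is an irrelevant field, so that it does not single out a world.

record KripkeModel (S : Signature) : Set₁ where
  constructor kripke
  field
    frame     : Frame S
    .nonempty : Frame.Point frame
    V         : Letter S → Frame.Point frame → Set
  open Frame frame public renaming (Point to World)

record ActionModel (S : Signature) (Form : Set₁) : Set₁ where
  inductive
  pattern
  constructor action
  field
    frame  : Frame S
    finite : NonemptyFinite (Frame.Point frame)
    pre    : Frame.Point frame → Form
  open Frame frame public renaming (Point to Event)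

infixr 6 _∧'_

data Formula (S : Signature) : Set₁ where
  atom   : Letter S → Formula S
  ¬'_    : Formula S → Formula S
  _∧'_   : Formula S → Formula S → Formula S
  □      : Agent S → Formula S → Formula S
  [Y]_   : Formula S → Formula S
  [_∣_]_ : (U : ActionModel S (Formula S)) → ActionModel.Event U → Formula S → Formula S

-- The pairs (v , t) at which Sat holds.  The proof is irrelevant, so equality
-- of such worlds is equality of pairs.

record ProductWorld {W E : Set} (Sat : W → E → Set) : Set where
  constructor ⟨_,_,_⟩
  field
    world : W
    event : E
    .sat  : Sat world event

open ProductWorld public

-- The product construction, with satisfaction of preconditions as a parameter:
-- Sat v t stands for "M ∣ v ⊨ pre t".

module _ {S : Signature} (M : KripkeModel S) (E : Frame S)
         (Sat : KripkeModel.World M → Frame.Point E → Set) where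
  private
    module M = KripkeModel M
    module E = Frame E

  productFrame : Frame S
  productFrame = record
    { Point   = ProductWorld Sat
    ; _⟶⟨_⟩_ = λ x a x' → (world x M.⟶⟨ a ⟩ world x') × (event x E.⟶⟨ a ⟩ event x')
    ; _⇝_     = λ x' x →
        (world x' M.⇝ world x × event x' ≡ event x × PastState E (event x))
        ⊎ (world x' ≡ world x × event x' E.⇝ event x)
    }

  productModel : .(ProductWorld Sat) → KripkeModel S
  productModel x = kripke productFrame x (λ p y → M.V p (world y))

infix 3 _∣_⊨_

_∣_⊨_ : {S : Signature} (M : KripkeModel S) → KripkeModel.World M → Formula S → Set
M ∣ w ⊨ atom p  = KripkeModel.V M p w
M ∣ w ⊨ ¬' φ    = ¬ (M ∣ w ⊨ φ)
M ∣ w ⊨ φ ∧' ψ  = (M ∣ w ⊨ φ) × (M ∣ w ⊨ ψ)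
M ∣ w ⊨ □ a φ   = ∀ v → KripkeModel._⟶⟨_⟩_ M w a v → M ∣ v ⊨ φ
M ∣ w ⊨ [Y] φ   = ∀ v → KripkeModel._⇝_ M v w → M ∣ v ⊨ φ
M ∣ w ⊨ [ action E _ pre ∣ s ] φ =
  (h : M ∣ w ⊨ pre s) →
  productModel M E (λ v t → M ∣ v ⊨ pre t) ⟨ w , s , h ⟩ ∣ ⟨ w , s , h ⟩ ⊨ φ

-- The model M[U]; the last argument makes it nonempty.

product : {S : Signature} (M : KripkeModel S) (U : ActionModel S (Formula S)) →
          (w : KripkeModel.World M) (s : ActionModel.Event U) →
          .(M ∣ w ⊨ ActionModel.pre U s) → KripkeModel S
product M U w s h =
  productModel M (ActionModel.frame U) (λ v t → M ∣ v ⊨ ActionModel.pre U t) ⟨ w , s , h ⟩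

Valid : {S : Signature} → Formula S → Set₁
Valid {S} φ = (M : KripkeModel S) (w : KripkeModel.World M) → M ∣ w ⊨ φ

-- ⊨ φ → ψ, with the truth clause of implication written out, since implication
-- is not a primitive connective.

ValidImplication : {S : Signature} → Formula S → Formula S → Set₁
ValidImplication {S} φ ψ =
  (M : KripkeModel S) (w : KripkeModel.World M) → M ∣ w ⊨ φ → M ∣ w ⊨ ψ

PersistenceOfFacts : {S : Signature} → KripkeModel S → Set
PersistenceOfFacts M = ∀ {w w'} → w ⇝ w' → ∀ p → V p w ⇔ V p w'
  where open KripkeModel M

module _ {S : Signature} (U : ActionModel S (Formula S)) where
  open ActionModel U

  EpistemicPastState : Event → Set₁
  EpistemicPastState s =
    PastState frame s
    × Valid (pre s)
    × (∀ a → s ⟶⟨ a ⟩ s)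
    × (∀ a t → s ⟶⟨ a ⟩ t → t ≡ s)

  HistoryPreserving : Set₁
  HistoryPreserving =
    (∀ {s' s} → s' ⇝ s → ValidImplication (pre s) (pre s'))
    × (∀ s → PastState frame s → EpistemicPastState s)

{-# OPTIONS --safe #-}
module Submission where

-- A step into the past in M[U] is a past step of exactly one of M and U, so a
-- progression of M[U] projects to progressions of M and U whose lengths add up.
-- For (b), depth-definedness is equivalent (up to double negation) to a bound on
-- the lengths of all progressions ending at a point, and such bounds add.  For
-- (g), history preservation also lets a history of U ending at s, preceded by a
-- history of M ending at w, be lifted to M[U], so that
-- depth (w , s) = depth w + depth s.

open import Data.Nat.Base using (ℕ; zero; suc; _+_; _≤_; s≤s)
open import Data.Nat.Properties using (+-suc; +-mono-≤; +-cancelˡ-≤; +-cancelʳ-≤; <-irrefl; ≤-trans; m≤n+m; m≤n⇒m<n∨m≡n; _≤?_)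
open import Data.Product.Base using (∃-syntax; _×_; _,_; proj₁; proj₂)
open import Data.Sum.Base using (inj₁; inj₂)
open import Function.Bundles using (mk⇔; Equivalence)
open import Function.Construct.Identity using (⇔-id)
open import Relation.Binary.PropositionalEquality using (_≡_; refl; sym)
open import Relation.Nullary.Construct.Add.Supremum using () renaming ([_] to fin; ⊤⁺ to ∞)
open import Relation.Nullary.Decidable using (decidable-stable)
open import Relation.Nullary.Negation using (¬_; contradiction)
open import Defs
open KripkeModel using (World) renaming (frame to frameᴹ)
open ActionModel using (Event; pre) renaming (frame to frameᵁ)

-- Progressions and depth in a single frame.

module _ {S : Signature} (F : Frame S) where
  open Frame F

  ProgressionBound : Point → ℕ → Set
  ProgressionBound x N = ∀ {x₀ n} → Progression F x₀ x n → n ≤ N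

  _++ₚ_ : ∀ {x y z m n} → Progression F x y m → Progression F y z n →
          Progression F x z (m + n)
  single  ++ₚ q = q
  (s ∷ p) ++ₚ q = s ∷ (p ++ₚ q)

  -- A progression of length n extends, at its beginning, to a history of
  -- length at least n, because its first point has some history.
  maxHistoryLength⇒progressionBound : DepthDefined F → ∀ {x N} →
    MaxHistoryLength F x N → ∀ {x₀ n} → Progression F x₀ x n → ¬ ¬ (n ≤ N)
  maxHistoryLength⇒progressionBound dd (_ , max) {x₀} {n} p ¬n≤N =
    dd x₀ λ where
      (k , (y , q , past) , _) →
        ¬n≤N (≤-trans (m≤n+m n k) (max (k + n) (y , q ++ₚ p , past)))

  -- A yesterday of `x₀` would prolong `p` to length `suc N`, so a progression attaining the bound
  -- is already a history.
  maximalProgression⇒maxHistoryLength : ∀ {x x₀ N} → ProgressionBound x N →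
    Progression F x₀ x N → MaxHistoryLength F x N
  maximalProgression⇒maxHistoryLength {x₀ = x₀} bound p =
    (x₀ , p , λ (_ , s) → contradiction (bound (s ∷ p)) (<-irrefl refl)) ,
    λ _ (_ , q , _) → bound q

  -- Whether the bound is attained cannot be decided in general, so the induction runs under `¬max`:
  -- no progression then has length `suc N`, and the bound drops by one. At bound zero, `single`
  -- attains it.
  progressionBound⇒maxHistoryLength : ∀ {x} N → ProgressionBound x N →
    ¬ ¬ (∃[ n ] MaxHistoryLength F x n)
  progressionBound⇒maxHistoryLength zero bound ¬max =
    ¬max (zero , maximalProgression⇒maxHistoryLength bound single)
  progressionBound⇒maxHistoryLength {x} (suc N) bound ¬max =
    progressionBound⇒maxHistoryLength N smaller ¬max
    where
    smaller : ProgressionBound x N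
    smaller p with m≤n⇒m<n∨m≡n (bound p)
    ... | inj₁ (s≤s n≤N) = n≤N
    ... | inj₂ refl = contradiction (suc N , maximalProgression⇒maxHistoryLength bound p) ¬max

  depthDefined⇒progressionBound : DepthDefined F → ∀ x →
    ¬ ¬ (∃[ N ] ProgressionBound x N)
  depthDefined⇒progressionBound dd x ¬bound =
    dd x λ (N , max) → ¬bound
      -- The order on numbers is decidable, so the double negation on the inequality can be removed.
      (N , λ p → decidable-stable (_ ≤? N) (maxHistoryLength⇒progressionBound dd max p))

  sameDepth : ∀ {x y} →
    (∀ {n} → MaxHistoryLength F x n → MaxHistoryLength F y n) →
    (∀ {n} → MaxHistoryLength F y n → MaxHistoryLength F x n) →
    SameDepth F x y
  sameDepth f g (fin n) = mk⇔ f g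
  sameDepth f g ∞       = mk⇔ (λ ¬max (n , max) → ¬max (n , g max))
                              (λ ¬max (n , max) → ¬max (n , f max))

-- Products over an arbitrary satisfaction relation.

module _ {S : Signature} (M : KripkeModel S) (E : Frame S)
         (Sat : World M → Frame.Point E → Set) where
  private
    P = productFrame M E Sat

  product-persistenceOfFacts : .(x : ProductWorld Sat) → PersistenceOfFacts M →
    PersistenceOfFacts (productModel M E Sat x)
  product-persistenceOfFacts _ pf (inj₁ (w⇝v , _)) p = pf w⇝v p
  product-persistenceOfFacts _ pf (inj₂ (refl , _)) p = ⇔-id _

  -- Two yesterdays of one point arise in the same way: a step in `M` requires the event to be a
  -- past state, and a step in `E` refutes that. As `sat` is irrelevant, equal coordinates then give
  -- equal points.
  product-uniquenessOfThePast : UniquenessOfThePast (frameᴹ M) →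
    UniquenessOfThePast E → UniquenessOfThePast P
  product-uniquenessOfThePast uM uE (inj₁ (s , refl , _)) (inj₁ (t , refl , _))
    with refl ← uM s t = refl
  product-uniquenessOfThePast uM uE (inj₁ (_ , _ , past)) (inj₂ (_ , t)) =
    contradiction (_ , t) past
  product-uniquenessOfThePast uM uE (inj₂ (_ , s)) (inj₁ (_ , _ , past)) =
    contradiction (_ , s) past
  product-uniquenessOfThePast uM uE (inj₂ (refl , s)) (inj₂ (refl , t))
    with refl ← uE s t = refl

  project : ∀ {x y n} → Progression P x y n →
    ∃[ m ] ∃[ k ] (n ≡ m + k × Progression (frameᴹ M) (world x) (world y) m
                             × Progression E (event x) (event y) k)
  project single = 0 , 0 , refl , single , single
  project (inj₁ (s , refl , _) ∷ p) with project p
  ... | m , k , refl , q , r = suc m , k , refl , s ∷ q , r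
  project (inj₂ (refl , s) ∷ p) with project p
  ... | m , k , refl , q , r = m , suc k , sym (+-suc m k) , q , s ∷ r

  product-depthDefined : DepthDefined (frameᴹ M) → DepthDefined E → DepthDefined P
  product-depthDefined ddM ddE x ¬max =
    -- The goal is absurdity, so both doubly negated bounds can be opened.
    depthDefined⇒progressionBound (frameᴹ M) ddM (world x) λ (N , boundM) →
    depthDefined⇒progressionBound E ddE (event x) λ (K , boundE) →
    progressionBound⇒maxHistoryLength P (N + K) (bound boundM boundE) ¬max
    where
    bound : ∀ {N K} → ProgressionBound (frameᴹ M) (world x) N →
            ProgressionBound E (event x) K → ProgressionBound P x (N + K)
    bound boundM boundE p with project p
    ... | m , k , refl , q , r = +-mono-≤ (boundM q) (boundE r)

-- Consequences of history preservation.

module _ {S : Signature} (M : KripkeModel S) (U : ActionModel S (Formula S))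
         (hp : HistoryPreserving U) where
  open ActionModel U using () renaming (_⇝_ to _⇝ᵁ_; _⟶⟨_⟩_ to _⟶ᵁ⟨_⟩_)
  private
    Sat : World M → Event U → Set
    Sat w s = M ∣ w ⊨ pre U s

    P = productFrame M (frameᵁ U) Sat

  pre-preserved : ∀ {s' s} → s' ⇝ᵁ s → ∀ w → Sat w s → Sat w s'
  pre-preserved s'⇝s w = proj₁ hp s'⇝s M w

  pre-pastState : ∀ {s} → PastState (frameᵁ U) s → ∀ w → Sat w s
  pre-pastState past w with _ , valid , _ ← proj₂ hp _ past = valid M w

  pastState-refl : ∀ {s} → PastState (frameᵁ U) s → ∀ a → s ⟶ᵁ⟨ a ⟩ s
  pastState-refl past with _ , _ , reflexive , _ ← proj₂ hp _ past = reflexive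

  pastState-only : ∀ {s t a} → PastState (frameᵁ U) s → s ⟶ᵁ⟨ a ⟩ t → t ≡ s
  pastState-only past with _ , _ , _ , only ← proj₂ hp _ past = only _ _

  -- The event comes first: only at a past state does a yesterday of the world lift to the product,
  -- where the valid precondition makes the new pair a point.
  product-pastState : ∀ {x} → PastState P x →
    PastState (frameᴹ M) (world x) × PastState (frameᵁ U) (event x)
  product-pastState {⟨ w , s , h ⟩} past = pastM , pastU
    where
    pastU : PastState (frameᵁ U) s
    pastU (s' , s'⇝s) =
      past (⟨ w , s' , pre-preserved s'⇝s w h ⟩ , inj₂ (refl , s'⇝s))

    pastM : PastState (frameᴹ M) w
    pastM (w' , w'⇝w) =
      past (⟨ w' , s , pre-pastState pastU w' ⟩ , inj₁ (w'⇝w , refl , pastU))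

  pastState-product : ∀ {x} → PastState (frameᴹ M) (world x) →
    PastState (frameᵁ U) (event x) → PastState P x
  pastState-product pastM pastU (_ , inj₁ (s , _)) = pastM (_ , s)
  pastState-product pastM pastU (_ , inj₂ (_ , s)) = pastU (_ , s)

  -- After a step in `M` the event is an epistemic past state, so the arrow leaves it fixed and its
  -- precondition holds at `v'`. After a step in `U` the world `v` is kept and preconditions pass to
  -- yesterdays.
  product-knowledgeOfThePast : KnowledgeOfThePast (frameᴹ M) →
    KnowledgeOfThePast (frameᵁ U) → KnowledgeOfThePast P
  product-knowledgeOfThePast kM kU (inj₁ (w'⇝w , _ , past)) (w→v , s→t)
    with refl ← pastState-only past s→t | v' , v'⇝v ← kM w'⇝w w→v =
    ⟨ v' , _ , pre-pastState past v' ⟩ , inj₁ (v'⇝v , refl , past)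
  product-knowledgeOfThePast kM kU {v = ⟨ v , _ , h ⟩} (inj₂ (_ , s'⇝s)) (_ , s→t)
    with t' , t'⇝t ← kU s'⇝s s→t =
    ⟨ v , t' , pre-preserved t'⇝t v h ⟩ , inj₂ (refl , t'⇝t)

  product-knowledgeOfTheInitialTime : KnowledgeOfTheInitialTime (frameᴹ M) →
    KnowledgeOfTheInitialTime P
  product-knowledgeOfTheInitialTime kM {w = x} {v = y} (w→v , s→t) past
    with pastM , pastU ← product-pastState {x} past
    with refl ← pastState-only pastU s→t =
    pastState-product {y} (kM w→v pastM) pastU

  product-perfectRecall : PerfectRecall (frameᴹ M) → PerfectRecall (frameᵁ U) →
    PerfectRecall P
  product-perfectRecall rM rU (inj₁ (w⇝v , refl , past)) (v→v' , t→t')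
    with refl ← pastState-only past t→t' | w' , w→w' , w'⇝v' ← rM w⇝v v→v' =
    ⟨ w' , _ , pre-pastState past w' ⟩ ,
    -- The event does not change here, so its arrow is the reflexive one.
    (w→w' , pastState-refl past _) , inj₁ (w'⇝v' , refl , past)
  product-perfectRecall rM rU {v' = ⟨ v' , _ , h ⟩} (inj₂ (refl , s⇝t)) (v→v' , t→t')
    with s' , s→s' , s'⇝t' ← rU s⇝t t→t' =
    ⟨ v' , s' , pre-preserved s'⇝t' v' h ⟩ , (v→v' , s→s') , inj₂ (refl , s'⇝t')

  -- Additivity of depth, and synchronicity.

  pre-preserved* : ∀ {s₀ s k} → Progression (frameᵁ U) s₀ s k →
    ∀ w → Sat w s → Sat w s₀
  pre-preserved* single  w h = h
  pre-preserved* (s ∷ p) w h = pre-preserved s w (pre-preserved* p w h)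

  liftᵁ : ∀ {s₀ s k w} → (p : Progression (frameᵁ U) s₀ s k) → .(h : Sat w s) →
    Progression P ⟨ w , s₀ , pre-preserved* p w h ⟩ ⟨ w , s , h ⟩ k
  liftᵁ single  h = single
  liftᵁ (s ∷ p) h = inj₂ (refl , s) ∷ liftᵁ p h

  liftᴹ : ∀ {w₀ w s m} → (past : PastState (frameᵁ U) s) →
    Progression (frameᴹ M) w₀ w m →
    Progression P ⟨ w₀ , s , pre-pastState past w₀ ⟩ ⟨ w , s , pre-pastState past w ⟩ m
  liftᴹ past single  = single
  liftᴹ past (s ∷ p) = inj₁ (s , refl , past) ∷ liftᴹ past p

  history-product : ∀ {x m k} → HistoryEndingAt (frameᴹ M) (world x) m →
    HistoryEndingAt (frameᵁ U) (event x) k → HistoryEndingAt P x (m + k)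
  history-product {⟨ w , s , h ⟩} (w₀ , p , pastM) (s₀ , q , pastU) =
    -- The two lifts meet at world `w` and event `s₀`; their satisfaction proofs there are
    -- identified by irrelevance.
    x₀ , _++ₚ_ P (liftᴹ pastU p) (liftᵁ q h) , pastState-product {x₀} pastM pastU
    where
    x₀ : ProductWorld Sat
    x₀ = ⟨ w₀ , s₀ , pre-pastState pastU w₀ ⟩

  product-history : ∀ {x n} → HistoryEndingAt P x n →
    ∃[ m ] ∃[ k ] (n ≡ m + k × HistoryEndingAt (frameᴹ M) (world x) m
                             × HistoryEndingAt (frameᵁ U) (event x) k)
  product-history (x₀ , p , past)
    with m , k , n≡m+k , q , r ← project M (frameᵁ U) Sat p | pastM , pastU ← product-pastState {x₀} past =
    m , k , n≡m+k , (_ , q , pastM) , (_ , r , pastU)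

  maxHistoryLength-product : ∀ {x m k} →
    MaxHistoryLength (frameᴹ M) (world x) m →
    MaxHistoryLength (frameᵁ U) (event x) k → MaxHistoryLength P x (m + k)
  maxHistoryLength-product {x} {m} {k} (hM , maxM) (hU , maxU) =
    history-product hM hU , max
    where
    max : ∀ n → HistoryEndingAt P x n → n ≤ m + k
    max n h with m' , k' , refl , hM' , hU' ← product-history h =
      +-mono-≤ (maxM m' hM') (maxU k' hU')

  -- Both projections of a longest history are longest: a longer history in one factor, combined
  -- with the projection in the other, would give a longer one in the product.
  product-maxHistoryLength : ∀ {x n} → MaxHistoryLength P x n →
    ∃[ m ] ∃[ k ] (n ≡ m + k × MaxHistoryLength (frameᴹ M) (world x) m
                             × MaxHistoryLength (frameᵁ U) (event x) k)
  product-maxHistoryLength (h , max)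
    with m , k , refl , hM , hU ← product-history h =
    m , k , refl ,
    (hM , λ m' hM' → +-cancelʳ-≤ k m' m (max _ (history-product hM' hU))) ,
    (hU , λ k' hU' → +-cancelˡ-≤ m k' k (max _ (history-product hM hU')))

  -- The depth at one end of an arrow splits into two summands; each is carried along its own
  -- component of the arrow, and the sum is reassembled at the other end.
  product-synchronous : Synchronous (frameᴹ M) → Synchronous (frameᵁ U) →
    Synchronous P
  product-synchronous (ddM , syncM) (ddU , syncU) =
    product-depthDefined M (frameᵁ U) Sat ddM ddU , λ {x} {y} (w→v , s→t) → sameDepth P
      (transfer {x} {y} (Equivalence.to (syncM w→v (fin _))) (Equivalence.to (syncU s→t (fin _))))
      (transfer {y} {x} (Equivalence.from (syncM w→v (fin _))) (Equivalence.from (syncU s→t (fin _))))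
    where
    transfer : ∀ {x y} →
      (∀ {m} → MaxHistoryLength (frameᴹ M) (world x) m →
               MaxHistoryLength (frameᴹ M) (world y) m) →
      (∀ {k} → MaxHistoryLength (frameᵁ U) (event x) k →
               MaxHistoryLength (frameᵁ U) (event y) k) →
      ∀ {n} → MaxHistoryLength P x n → MaxHistoryLength P y n
    transfer f g max with m , k , refl , maxM , maxU ← product-maxHistoryLength max =
      maxHistoryLength-product (f maxM) (g maxU)

theorem19 : (S : Signature) (M : KripkeModel S) (U : ActionModel S (Formula S))
    (w* : World M) (s* : Event U) (h : M ∣ w* ⊨ pre U s*) →
    let M[U] = product M U w* s* h in
    (PersistenceOfFacts M → PersistenceOfFacts M[U])
    × (DepthDefined (frameᴹ M) → DepthDefined (frameᵁ U) →
    DepthDefined (frameᴹ M[U]))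
    × (KnowledgeOfThePast (frameᴹ M) → KnowledgeOfThePast (frameᵁ U) →
    HistoryPreserving U → KnowledgeOfThePast (frameᴹ M[U]))
    × (KnowledgeOfTheInitialTime (frameᴹ M) → HistoryPreserving U →
    KnowledgeOfTheInitialTime (frameᴹ M[U]))
    × (UniquenessOfThePast (frameᴹ M) → UniquenessOfThePast (frameᵁ U) →
    UniquenessOfThePast (frameᴹ M[U]))
    × (PerfectRecall (frameᴹ M) → PerfectRecall (frameᵁ U) →
    HistoryPreserving U → PerfectRecall (frameᴹ M[U]))
    × (Synchronous (frameᴹ M) → Synchronous (frameᵁ U) →
    HistoryPreserving U → Synchronous (frameᴹ M[U]))
theorem19 S M U w* s* h =
  product-persistenceOfFacts M (frameᵁ U) Sat ⟨ w* , s* , h ⟩ ,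
  product-depthDefined M (frameᵁ U) Sat ,
  (λ kM kU hp {w'} {w} {v} →
     product-knowledgeOfThePast M U hp kM kU {w'} {w} {v}) ,
  (λ kM hp {w} {v} → product-knowledgeOfTheInitialTime M U hp kM {w} {v}) ,
  product-uniquenessOfThePast M (frameᵁ U) Sat ,
  (λ rM rU hp {w} {v} {v'} →
     product-perfectRecall M U hp rM rU {w} {v} {v'}) ,
  (λ syncM syncU hp → product-synchronous M U hp syncM syncU)
  where
  Sat : World M → Event U → Set
  Sat w s = M ∣ w ⊨ pre U s
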